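{- Let $\Gamma$ be a (possibly infinite) set of moded propositions and $P$ a moded proposition. If $\Gamma \vdash P$ holds in $\textsc{prk}$, then $P$ is a semantic consequence of $\Gamma$ in Kripke models for $\textsc{prk}$: for every Kripke model $\mathcal{M}$ and every world $w$ of $\mathcal{M}$, if $\mathcal{M},w \Vdash Q$ for every $Q\in\Gamma$, then $\mathcal{M},w\Vdash P$.
   Context: **Propositions.** Fix a denumerable set of propositional variables $\alpha,\beta,\dots$. Pure propositions: $A,B ::= \alpha \mid A\land B\mid A\lor B\mid \neg A$. (Moded) propositions: $P,Q ::= A^+\mid A^-\mid A^\oplus\mid A^\ominus$ with $A$ pure; $A^+,A^-$ are strong, $A^\oplus,A^\ominus$ are classical. The opposite $P^\sim$ is: $(A^+)^\sim=A^-$, $(A^-)^\sim=A^+$, $(A^\oplus)^\sim=A^\ominus$, $(A^\ominus)^\sim=A^\oplus$. **System $\textsc{prk}$.** Judgments $\Gamma\vdash P$ with $\Gamma$ a finite set of propositions ($\Gamma,P$ means $\Gamma\cup\{P\}$), derivable by the rules (for $i\in\{1,2\}$): - (Ax) $\Gamma,P\vdash P$. (Abs) From $\Gamma\vdash P$ and $\Gamma\vdash P^\sim$ with $P$ strong, infer $\Gamma\vdash Q$ (any $Q$). - (I$\land^+$) From $\Gamma\vdash A^\oplus$ and $\Gamma\vdash B^\oplus$ infer $\Gamma\vdash(A\land B)^+$. (I$\lor^-$) From $\Gamma\vdash A^\ominus$ and $\Gamma\vdash B^\ominus$ infer $\Gamma\vdash(A\lor B)^-$. - (E$\land^+_i$)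 From $\Gamma\vdash(A_1\land A_2)^+$ infer $\Gamma\vdash A_i^\oplus$. (E$\lor^-_i$) From $\Gamma\vdash(A_1\lor A_2)^-$ infer $\Gamma\vdash A_i^\ominus$. - (I$\lor^+_i$) From $\Gamma\vdash A_i^\oplus$ infer $\Gamma\vdash(A_1\lor A_2)^+$. (I$\land^-_i$) From $\Gamma\vdash A_i^\ominus$ infer $\Gamma\vdash(A_1\land A_2)^-$. - (E$\lor^+$) From $\Gamma\vdash(A\lor B)^+$, $\Gamma,A^\oplus\vdash P$ and $\Gamma,B^\oplus\vdash P$ infer $\Gamma\vdash P$. (E$\land^-$) From $\Gamma\vdash(A\land B)^-$, $\Gamma,A^\ominus\vdash P$ and $\Gamma,B^\ominus\vdash P$ infer $\Gamma\vdash P$. - (I$\neg^+$) From $\Gamma\vdash A^\ominus$ infer $\Gamma\vdash(\neg A)^+$. (I$\neg^-$) From $\Gamma\vdash A^\oplus$ infer $\Gamma\vdash(\neg A)^-$. (E$\neg^+$) From $\Gamma\vdash(\neg A)^+$ infer $\Gamma\vdash A^\ominus$. (E$\neg^-$) From $\Gamma\vdash(\neg A)^-$ infer $\Gamma\vdash A^\oplus$. - (IC$^+$) From $\Gamma,A^\ominus\vdash A^+$ infer $\Gamma\vdash A^\oplus$. (IC$^-$) From $\Gamma,A^\oplus\vdash A^-$ infer $\Gamma\vdash A^\ominus$. - (EC$^+$) From $\Gamma\vdash A^\oplus$ and $\Gamma\vdash A^\ominus$ infer $\Gamma\vdash A^+$. (EC$^-$) From $\Gamma\vdash A^\ominus$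 and $\Gamma\vdash A^\oplus$ infer $\Gamma\vdash A^-$. For a possibly infinite set $\Gamma$, $\Gamma\vdash P$ means $\Delta\vdash P$ is derivable for some finite $\Delta\subseteq\Gamma$. **Kripke models.** A Kripke model (for $\textsc{prk}$) is $\mathcal{M}=(\mathcal{W},\le,\mathcal{V}^+,\mathcal{V}^-)$ where $\mathcal{W}$ is a set of worlds, $\le$ is a partial order on $\mathcal{W}$, and for each $w\in\mathcal W$, $\mathcal{V}^+_w$ and $\mathcal{V}^-_w$ are sets of propositional variables such that: (Monotonicity) if $w\le w'$ then $\mathcal V^+_w\subseteq\mathcal V^+_{w'}$ and $\mathcal V^-_w\subseteq\mathcal V^-_{w'}$; (Stabilization) for all $w\in\mathcal W$ and all $\alpha$ there is $w'\ge w$ with $\alpha\in\mathcal V^+_{w'}\,\triangle\,\mathcal V^-_{w'}$ (symmetric difference). **Forcing.** $\mathcal M,w\Vdash P$ is defined by recursion on the measure $\#(A^+)=\#(A^-)=2|A|$, $\#(A^\oplus)=\#(A^\ominus)=2|A|+1$, where $|A|$ is the number of symbols of $A$: - $w\Vdash\alpha^+$ iff $\alpha\in\mathcal V^+_w$; $w\Vdash\alpha^-$ iff $\alpha\in\mathcal V^-_w$; - $w\Vdash(A\land B)^+$ iff $w\Vdash A^\oplus$ and $w\Vdash B^\oplus$; $w\Vdash(A\land B)^-$ iff $w\Vdash A^\ominus$ or $w\Vdash B^\ominus$; - $w\Vdash(A\lor B)^+$ iff $w\Vdash A^\oplus$ or $w\Vdash B^\oplus$; $w\Vdash(A\lor B)^-$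 iff $w\Vdash A^\ominus$ and $w\Vdash B^\ominus$; - $w\Vdash(\neg A)^+$ iff $w\Vdash A^\ominus$; $w\Vdash(\neg A)^-$ iff $w\Vdash A^\oplus$; - $w\Vdash A^\oplus$ iff $w'\nVdash A^-$ for all $w'\ge w$; $w\Vdash A^\ominus$ iff $w'\nVdash A^+$ for all $w'\ge w$. -}

module Defs where

open import Data.List.Base using (List; _∷_)
open import Data.List.Membership.Propositional using () renaming (_∈_ to _∈ˡ_)
open import Data.List.Relation.Binary.Subset.Propositional using (_⊆_)
open import Data.List.Relation.Binary.Subset.Propositional.Properties using (∷⁺ʳ)
open import Data.List.Relation.Unary.All using (All)
open import Data.Nat.Base using (ℕ)
open import Data.Product.Base using (∃-syntax; _×_)
open import Data.Sum.Base using (_⊎_)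
open import Level using (Level; suc)
open import Relation.Binary.Bundles using (Poset)
open import Relation.Nullary.Negation.Core using (¬_)
open import Relation.Unary using (Pred; _∈_; _∪_; _∖_) renaming (_⊆_ to _⊆ᴾ_)

private
  variable
    a ℓ ℓ₁ ℓ₂ : Level

Var : Set
Var = ℕ

infix  9 ¬'_
infixr 8 _∧_
infixr 7 _∨_

data Pure : Set where
  var     : Var → Pure
  _∧_ _∨_ : Pure → Pure → Pure
  ¬'_     : Pure → Pure

infix 6 _⁺ _⁻ _⊕ _⊖

data Proposition : Set where
  _⁺ _⁻ _⊕ _⊖ : Pure → Proposition

data Strong : Proposition → Set where
  strong⁺ : ∀ {A} → Strong (A ⁺)
  strong⁻ : ∀ {A} → Strong (A ⁻)

infix 6 _~

_~ : Proposition → Proposition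
(A ⁺) ~ = A ⁻
(A ⁻) ~ = A ⁺
(A ⊕) ~ = A ⊖
(A ⊖) ~ = A ⊕

private
  variable
    A B   : Pure
    P Q   : Proposition
    Γ Δ   : List Proposition

-- A finite set of propositions is represented by any list of its elements,
-- with Γ , P rendered as P ∷ Γ.  Since hypotheses are used only through
-- membership, order and multiplicity are irrelevant; see ⊢-resp-⊆ below.

infix 4 _⊢_

data _⊢_ (Γ : List Proposition) : Proposition → Set where
  Ax   : P ∈ˡ Γ → Γ ⊢ P
  Abs  : Strong P → Γ ⊢ P → Γ ⊢ P ~ → Γ ⊢ Q

  I∧⁺  : Γ ⊢ A ⊕ → Γ ⊢ B ⊕ → Γ ⊢ (A ∧ B) ⁺
  I∨⁻  : Γ ⊢ A ⊖ → Γ ⊢ B ⊖ → Γ ⊢ (A ∨ B) ⁻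

  E∧⁺₁ : Γ ⊢ (A ∧ B) ⁺ → Γ ⊢ A ⊕
  E∧⁺₂ : Γ ⊢ (A ∧ B) ⁺ → Γ ⊢ B ⊕
  E∨⁻₁ : Γ ⊢ (A ∨ B) ⁻ → Γ ⊢ A ⊖
  E∨⁻₂ : Γ ⊢ (A ∨ B) ⁻ → Γ ⊢ B ⊖

  I∨⁺₁ : Γ ⊢ A ⊕ → Γ ⊢ (A ∨ B) ⁺
  I∨⁺₂ : Γ ⊢ B ⊕ → Γ ⊢ (A ∨ B) ⁺
  I∧⁻₁ : Γ ⊢ A ⊖ → Γ ⊢ (A ∧ B) ⁻
  I∧⁻₂ : Γ ⊢ B ⊖ → Γ ⊢ (A ∧ B) ⁻

  E∨⁺  : Γ ⊢ (A ∨ B) ⁺ → A ⊕ ∷ Γ ⊢ P → B ⊕ ∷ Γ ⊢ P → Γ ⊢ P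
  E∧⁻  : Γ ⊢ (A ∧ B) ⁻ → A ⊖ ∷ Γ ⊢ P → B ⊖ ∷ Γ ⊢ P → Γ ⊢ P

  I¬⁺  : Γ ⊢ A ⊖ → Γ ⊢ (¬' A) ⁺
  I¬⁻  : Γ ⊢ A ⊕ → Γ ⊢ (¬' A) ⁻
  E¬⁺  : Γ ⊢ (¬' A) ⁺ → Γ ⊢ A ⊖
  E¬⁻  : Γ ⊢ (¬' A) ⁻ → Γ ⊢ A ⊕

  IC⁺  : A ⊖ ∷ Γ ⊢ A ⁺ → Γ ⊢ A ⊕
  IC⁻  : A ⊕ ∷ Γ ⊢ A ⁻ → Γ ⊢ A ⊖

  EC⁺  : Γ ⊢ A ⊕ → Γ ⊢ A ⊖ → Γ ⊢ A ⁺
  EC⁻  : Γ ⊢ A ⊖ → Γ ⊢ A ⊕ → Γ ⊢ A ⁻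

⊢-resp-⊆ : Γ ⊆ Δ → Γ ⊢ P → Δ ⊢ P
⊢-resp-⊆ s (Ax p)      = Ax (s p)
⊢-resp-⊆ s (Abs p d e) = Abs p (⊢-resp-⊆ s d) (⊢-resp-⊆ s e)
⊢-resp-⊆ s (I∧⁺ d e)   = I∧⁺ (⊢-resp-⊆ s d) (⊢-resp-⊆ s e)
⊢-resp-⊆ s (I∨⁻ d e)   = I∨⁻ (⊢-resp-⊆ s d) (⊢-resp-⊆ s e)
⊢-resp-⊆ s (E∧⁺₁ d)    = E∧⁺₁ (⊢-resp-⊆ s d)
⊢-resp-⊆ s (E∧⁺₂ d)    = E∧⁺₂ (⊢-resp-⊆ s d)
⊢-resp-⊆ s (E∨⁻₁ d)    = E∨⁻₁ (⊢-resp-⊆ s d)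
⊢-resp-⊆ s (E∨⁻₂ d)    = E∨⁻₂ (⊢-resp-⊆ s d)
⊢-resp-⊆ s (I∨⁺₁ d)    = I∨⁺₁ (⊢-resp-⊆ s d)
⊢-resp-⊆ s (I∨⁺₂ d)    = I∨⁺₂ (⊢-resp-⊆ s d)
⊢-resp-⊆ s (I∧⁻₁ d)    = I∧⁻₁ (⊢-resp-⊆ s d)
⊢-resp-⊆ s (I∧⁻₂ d)    = I∧⁻₂ (⊢-resp-⊆ s d)
⊢-resp-⊆ s (E∨⁺ d e f) = E∨⁺ (⊢-resp-⊆ s d) (⊢-resp-⊆ (∷⁺ʳ _ s) e) (⊢-resp-⊆ (∷⁺ʳ _ s) f)
⊢-resp-⊆ s (E∧⁻ d e f) = E∧⁻ (⊢-resp-⊆ s d) (⊢-resp-⊆ (∷⁺ʳ _ s) e) (⊢-resp-⊆ (∷⁺ʳ _ s) f)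
⊢-resp-⊆ s (I¬⁺ d)     = I¬⁺ (⊢-resp-⊆ s d)
⊢-resp-⊆ s (I¬⁻ d)     = I¬⁻ (⊢-resp-⊆ s d)
⊢-resp-⊆ s (E¬⁺ d)     = E¬⁺ (⊢-resp-⊆ s d)
⊢-resp-⊆ s (E¬⁻ d)     = E¬⁻ (⊢-resp-⊆ s d)
⊢-resp-⊆ s (IC⁺ d)     = IC⁺ (⊢-resp-⊆ (∷⁺ʳ _ s) d)
⊢-resp-⊆ s (IC⁻ d)     = IC⁻ (⊢-resp-⊆ (∷⁺ʳ _ s) d)
⊢-resp-⊆ s (EC⁺ d e)   = EC⁺ (⊢-resp-⊆ s d) (⊢-resp-⊆ s e)
⊢-resp-⊆ s (EC⁻ d e)   = EC⁻ (⊢-resp-⊆ s d) (⊢-resp-⊆ s e)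

infix 4 _⊢∞_

_⊢∞_ : Pred Proposition ℓ → Proposition → Set ℓ
Γ ⊢∞ P = ∃[ Δ ] All (_∈ Γ) Δ × Δ ⊢ P

infixl 6 _△_

_△_ : {X : Set a} → Pred X ℓ₁ → Pred X ℓ₂ → Pred X _
S △ T = (S ∖ T) ∪ (T ∖ S)

record KripkeModel (ℓ : Level) : Set (suc ℓ) where
  field
    worlds : Poset ℓ ℓ ℓ

  open Poset worlds public using (_≤_) renaming (Carrier to World)

  field
    V⁺ V⁻         : World → Pred Var ℓ
    monotone⁺     : ∀ {w w′} → w ≤ w′ → V⁺ w ⊆ᴾ V⁺ w′
    monotone⁻     : ∀ {w w′} → w ≤ w′ → V⁻ w ⊆ᴾ V⁻ w′
    stabilization : ∀ w α → ∃[ w′ ] w ≤ w′ × α ∈ V⁺ w′ △ V⁻ w′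

-- One relation per mode, so that recursion on the measure
-- #(A⁺) = #(A⁻) = 2|A| < #(A⊕) = #(A⊖) = 2|A|+1 becomes structural on A.

module Forcing (M : KripkeModel ℓ) where
  open KripkeModel M

  infix 4 _⊩⁺_ _⊩⁻_ _⊩⊕_ _⊩⊖_ _⊩_

  _⊩⁺_ _⊩⁻_ _⊩⊕_ _⊩⊖_ : World → Pure → Set ℓ

  w ⊩⁺ var α = α ∈ V⁺ w
  w ⊩⁺ A ∧ B = w ⊩⊕ A × w ⊩⊕ B
  w ⊩⁺ A ∨ B = w ⊩⊕ A ⊎ w ⊩⊕ B
  w ⊩⁺ ¬' A  = w ⊩⊖ A

  w ⊩⁻ var α = α ∈ V⁻ w
  w ⊩⁻ A ∧ B = w ⊩⊖ A ⊎ w ⊩⊖ B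
  w ⊩⁻ A ∨ B = w ⊩⊖ A × w ⊩⊖ B
  w ⊩⁻ ¬' A  = w ⊩⊕ A

  w ⊩⊕ A = ∀ w′ → w ≤ w′ → ¬ (w′ ⊩⁻ A)
  w ⊩⊖ A = ∀ w′ → w ≤ w′ → ¬ (w′ ⊩⁺ A)

  _⊩_ : World → Proposition → Set ℓ
  w ⊩ A ⁺ = w ⊩⁺ A
  w ⊩ A ⁻ = w ⊩⁻ A
  w ⊩ A ⊕ = w ⊩⊕ A
  w ⊩ A ⊖ = w ⊩⊖ A

infix 4 _⊨[_]_

_⊨[_]_ : Pred Proposition a → (ℓ : Level) → Proposition → Set _
Γ ⊨[ ℓ ] P = (M : KripkeModel ℓ) (w : KripkeModel.World M) →
  let open Forcing M in (∀ Q → Q ∈ Γ → w ⊩ Q) → w ⊩ P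

{-# OPTIONS --safe #-}
module Submission where

open import Defs
open import Data.Empty using (⊥; ⊥-elim)
open import Data.List.Base using (List)
open import Data.List.Relation.Unary.All as All using (All; _∷_)
open import Data.Product.Base using (_,_; proj₁; proj₂)
open import Data.Sum.Base as Sum using (inj₁; inj₂)
open import Level using (Level)
open import Relation.Binary.Bundles using (Poset)
open import Relation.Unary using (Pred)

-- Forcing is persistent, and for every A no world forces both A⁺ and A⁻, nor
-- both A⊕ and A⊖.  The two exclusions hold by simultaneous induction on A; the
-- second is the constructive content of "some later world forces A⁺ or A⁻",
-- and stabilization enters only at variables.  Consequently A⁺ implies A⊕ and
-- A⁻ implies A⊖.  Soundness is then an induction on derivations; for IC⁺, a
-- later world forcing A⁻ would force A⊖, hence A⁺ by the premise.

module Soundness {ℓ : Level} (M : KripkeModel ℓ) where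
  open KripkeModel M
  open Poset worlds using (refl; trans)
  open Forcing M

  ⊩⊕-mono : ∀ A {w w′} → w ≤ w′ → w ⊩⊕ A → w′ ⊩⊕ A
  ⊩⊕-mono A w≤w′ a _ w′≤v = a _ (trans w≤w′ w′≤v)

  ⊩⊖-mono : ∀ A {w w′} → w ≤ w′ → w ⊩⊖ A → w′ ⊩⊖ A
  ⊩⊖-mono A w≤w′ a _ w′≤v = a _ (trans w≤w′ w′≤v)

  ⊩⁺-mono : ∀ A {w w′} → w ≤ w′ → w ⊩⁺ A → w′ ⊩⁺ A
  ⊩⁺-mono (var α) w≤w′ a       = monotone⁺ w≤w′ a
  ⊩⁺-mono (A ∧ B) w≤w′ (a , b) = ⊩⊕-mono A w≤w′ a , ⊩⊕-mono B w≤w′ b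
  ⊩⁺-mono (A ∨ B) w≤w′ c       = Sum.map (⊩⊕-mono A w≤w′) (⊩⊕-mono B w≤w′) c
  ⊩⁺-mono (¬' A)  w≤w′ a       = ⊩⊖-mono A w≤w′ a

  ⊩⁻-mono : ∀ A {w w′} → w ≤ w′ → w ⊩⁻ A → w′ ⊩⁻ A
  ⊩⁻-mono (var α) w≤w′ a       = monotone⁻ w≤w′ a
  ⊩⁻-mono (A ∧ B) w≤w′ c       = Sum.map (⊩⊖-mono A w≤w′) (⊩⊖-mono B w≤w′) c
  ⊩⁻-mono (A ∨ B) w≤w′ (a , b) = ⊩⊖-mono A w≤w′ a , ⊩⊖-mono B w≤w′ b
  ⊩⁻-mono (¬' A)  w≤w′ a       = ⊩⊕-mono A w≤w′ a

  ⊩-mono : ∀ P {w w′} → w ≤ w′ → w ⊩ P → w′ ⊩ P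
  ⊩-mono (A ⁺) = ⊩⁺-mono A
  ⊩-mono (A ⁻) = ⊩⁻-mono A
  ⊩-mono (A ⊕) = ⊩⊕-mono A
  ⊩-mono (A ⊖) = ⊩⊖-mono A

  -- The mutual recursion terminates: only the last two lemmas call another at the same `A`, namely
  -- the first, and every other call descends to a proper subformula.
  ⊩⁺⊩⁻⇒⊥ : ∀ A {w} → w ⊩⁺ A → w ⊩⁻ A → ⊥
  ⊩⊕⊩⊖⇒⊥ : ∀ A {w} → w ⊩⊕ A → w ⊩⊖ A → ⊥
  ⊩⁺⇒⊩⊕  : ∀ A {w} → w ⊩⁺ A → w ⊩⊕ A
  ⊩⁻⇒⊩⊖  : ∀ A {w} → w ⊩⁻ A → w ⊩⊖ A

  ⊩⁺⊩⁻⇒⊥ (var α) {w} p n with stabilization w α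
  -- At this later world `α` has exactly one sign, yet persistence gives it both.
  ... | _ , w≤v , inj₁ (_ , ¬n)     = ¬n (monotone⁻ w≤v n)
  ... | _ , w≤v , inj₂ (_ , ¬p)     = ¬p (monotone⁺ w≤v p)
  ⊩⁺⊩⁻⇒⊥ (A ∧ B) (a , b) (inj₁ a′)  = ⊩⊕⊩⊖⇒⊥ A a a′
  ⊩⁺⊩⁻⇒⊥ (A ∧ B) (a , b) (inj₂ b′)  = ⊩⊕⊩⊖⇒⊥ B b b′
  ⊩⁺⊩⁻⇒⊥ (A ∨ B) (inj₁ a) (a′ , b′) = ⊩⊕⊩⊖⇒⊥ A a a′
  ⊩⁺⊩⁻⇒⊥ (A ∨ B) (inj₂ b) (a′ , b′) = ⊩⊕⊩⊖⇒⊥ B b b′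
  ⊩⁺⊩⁻⇒⊥ (¬' A) a a′                = ⊩⊕⊩⊖⇒⊥ A a′ a

  ⊩⊕⊩⊖⇒⊥ (var α) {w} p n with stabilization w α
  ... | v , w≤v , inj₁ (α⁺ , _) = n v w≤v α⁺
  ... | v , w≤v , inj₂ (α⁻ , _) = p v w≤v α⁻
  -- `p` is used twice, to search for a world forcing `A ⁺` and then, above it, for one forcing
  -- `B ⁺`; that world `u` forces both `A ⊕` and `B ⊕`, against `n`.
  ⊩⊕⊩⊖⇒⊥ (A ∧ B) {w} p n = p w refl (inj₁ λ v w≤v a →
    p v w≤v (inj₂ λ u v≤u b →
      n u (trans w≤v v≤u) (⊩⊕-mono A v≤u (⊩⁺⇒⊩⊕ A a) , ⊩⁺⇒⊩⊕ B b)))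
  ⊩⊕⊩⊖⇒⊥ (A ∨ B) {w} p n = n w refl (inj₁ λ v w≤v a →
    n v w≤v (inj₂ λ u v≤u b →
      p u (trans w≤v v≤u) (⊩⊖-mono A v≤u (⊩⁻⇒⊩⊖ A a) , ⊩⁻⇒⊩⊖ B b)))
  ⊩⊕⊩⊖⇒⊥ (¬' A) {w} p n = p w refl λ v w≤v a → n v w≤v (⊩⁻⇒⊩⊖ A a)

  ⊩⁺⇒⊩⊕ A p _ w≤v n = ⊩⁺⊩⁻⇒⊥ A (⊩⁺-mono A w≤v p) n
  ⊩⁻⇒⊩⊖ A n _ w≤v p = ⊩⁺⊩⁻⇒⊥ A p (⊩⁻-mono A w≤v n)

  -- The world varies in the induction because `IC⁺` and `IC⁻` use their premise at a later world,
  -- to which persistence carries `γ`.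
  sound : ∀ {Γ : List Proposition} {P w} → Γ ⊢ P → All (w ⊩_) Γ → w ⊩ P
  sound (Ax P∈Γ) γ                     = All.lookup γ P∈Γ
  sound (Abs (strong⁺ {A}) d e) γ      = ⊥-elim (⊩⁺⊩⁻⇒⊥ A (sound d γ) (sound e γ))
  sound (Abs (strong⁻ {A}) d e) γ      = ⊥-elim (⊩⁺⊩⁻⇒⊥ A (sound e γ) (sound d γ))
  sound (I∧⁺ d e) γ                    = sound d γ , sound e γ
  sound (I∨⁻ d e) γ                    = sound d γ , sound e γ
  sound (E∧⁺₁ d) γ                     = proj₁ (sound d γ)
  sound (E∧⁺₂ d) γ                     = proj₂ (sound d γ)
  sound (E∨⁻₁ d) γ                     = proj₁ (sound d γ)
  sound (E∨⁻₂ d) γ                     = proj₂ (sound d γ)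
  sound (I∨⁺₁ d) γ                     = inj₁ (sound d γ)
  sound (I∨⁺₂ d) γ                     = inj₂ (sound d γ)
  sound (I∧⁻₁ d) γ                     = inj₁ (sound d γ)
  sound (I∧⁻₂ d) γ                     = inj₂ (sound d γ)
  sound (E∨⁺ d e f) γ with sound d γ
  ... | inj₁ a                         = sound e (a ∷ γ)
  ... | inj₂ b                         = sound f (b ∷ γ)
  sound (E∧⁻ d e f) γ with sound d γ
  ... | inj₁ a                         = sound e (a ∷ γ)
  ... | inj₂ b                         = sound f (b ∷ γ)
  sound (I¬⁺ d) γ                      = sound d γ
  sound (I¬⁻ d) γ                      = sound d γ
  sound (E¬⁺ d) γ                      = sound d γ
  sound (E¬⁻ d) γ                      = sound d γ
  sound (IC⁺ {A = A} d) γ v w≤v n      =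
    ⊩⁺⊩⁻⇒⊥ A (sound d (⊩⁻⇒⊩⊖ A n ∷ All.map (λ {Q} → ⊩-mono Q w≤v) γ)) n
  sound (IC⁻ {A = A} d) γ v w≤v p      =
    ⊩⁺⊩⁻⇒⊥ A p (sound d (⊩⁺⇒⊩⊕ A p ∷ All.map (λ {Q} → ⊩-mono Q w≤v) γ))
  -- No witness for `A ⁺` is built: the two premises are never forced together.
  sound (EC⁺ {A = A} d e) γ            = ⊥-elim (⊩⊕⊩⊖⇒⊥ A (sound d γ) (sound e γ))
  sound (EC⁻ {A = A} d e) γ            = ⊥-elim (⊩⊕⊩⊖⇒⊥ A (sound e γ) (sound d γ))

proposition11 : ∀ {a ℓ : Level} (Γ : Pred Proposition a) (P : Proposition) → Γ ⊢∞ P → Γ ⊨[ ℓ ] P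
proposition11 Γ P (Δ , Δ⊆Γ , d) M w w⊩Γ =
  Soundness.sound M d (All.map (λ {Q} → w⊩Γ Q) Δ⊆Γ)
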